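{- For every $n\ge 1$, the number of self-complementary noncrossing partitions of $[n]$ is $\binom{n}{\lfloor n/2\rfloor}$.
   Context: Write $[n]=\{1,2,\dots,n\}$. A partition of $[n]$ is noncrossing if no quadruple $a<b<c<d$ has $a,c$ in one block and $b,d$ in a different block. The complement $C(\pi)$ of a partition $\pi$ of $[n]$ is the partition obtained by replacing every element $i$ by $n+1-i$. A partition $\pi$ is self-complementary if $C(\pi)=\pi$. -}

module Defs where

open import Level using (0ℓ; suc; _⊔_)
open import Data.Nat.Base using (ℕ)
open import Data.Fin.Base using (Fin; _<_; opposite)
open import Data.Fin.Properties using (opposite-involutive)
open import Data.Fin.Subset using (Subset; Nonempty; _∈_)
open import Data.Product.Base using (Σ; ∃-syntax; _×_; _,_; proj₁)
open import Data.Vec.Base using (lookup; tabulate)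
open import Data.Vec.Properties using (lookup∘tabulate; []=⇒lookup; lookup⇒[]=)
open import Function.Base using (_∘_)
open import Function.Bundles using (_⇔_; Bijection)
open import Function.Construct.Composition using (_⇔-∘_)
open import Function.Construct.Identity using (⇔-id)
open import Function.Construct.Symmetry using (⇔-sym)
open import Relation.Binary.Bundles using (Setoid)
open import Relation.Binary.PropositionalEquality
  using (_≡_; _≢_; refl; sym; trans; cong; subst)
import Relation.Binary.PropositionalEquality.Properties as ≡
import Relation.Binary.Construct.On as On
open import Relation.Nullary.Negation using (¬_)
open import Relation.Unary using (Pred)

-- [n] is Fin n, whose element i (counted from 0) stands for i + 1.

record Partition (n : ℕ) : Set (suc 0ℓ) where
  field
    Block    : Pred (Subset n) 0ℓ
    nonempty : ∀ {A} → Block A → Nonempty A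
    cover    : ∀ i → ∃[ A ] (Block A × i ∈ A)
    disjoint : ∀ {A B i} → Block A → Block B → i ∈ A → i ∈ B → A ≡ B

open Partition public

infix 4 _≈_

-- Propositional equality would also compare the predicates and the proofs.
_≈_ : ∀ {n} → Partition n → Partition n → Set
π ≈ ρ = ∀ A → Block π A ⇔ Block ρ A

partitionSetoid : ℕ → Setoid (suc 0ℓ) 0ℓ
partitionSetoid n = record
  { Carrier       = Partition n
  ; _≈_           = _≈_
  ; isEquivalence = record
    { refl  = λ A → ⇔-id _
    ; sym   = λ p A → ⇔-sym (p A)
    ; trans = λ p q A → q A ⇔-∘ p A
    }
  }

Noncrossing : ∀ {n} → Partition n → Set
Noncrossing {n} π =
  ¬ (∃[ a ] ∃[ b ] ∃[ c ] ∃[ d ] (a < b × b < c × c < d ×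
      ∃[ A ] ∃[ B ] (Block π A × Block π B × A ≢ B ×
        (a ∈ A × c ∈ A) × (b ∈ B × d ∈ B))))

-- The image of A under i ↦ n + 1 - i, which is opposite when counting from 0;
-- as opposite is an involution, the image is also the preimage.
reflect : ∀ {n} → Subset n → Subset n
reflect A = tabulate (lookup A ∘ opposite)

∈-reflect⁻ : ∀ {n} {A : Subset n} {i} → i ∈ reflect A → opposite i ∈ A
∈-reflect⁻ {A = A} {i} i∈ = lookup⇒[]= (opposite i) A
  (trans (sym (lookup∘tabulate (lookup A ∘ opposite) i)) ([]=⇒lookup i∈))

∈-reflect⁺ : ∀ {n} {A : Subset n} {i} → i ∈ A → opposite i ∈ reflect A
∈-reflect⁺ {A = A} {i} i∈ = lookup⇒[]= (opposite i) (reflect A)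
  (trans (lookup∘tabulate (lookup A ∘ opposite) (opposite i))
  (trans (cong (lookup A) (opposite-involutive i)) ([]=⇒lookup i∈)))

complement : ∀ {n} → Partition n → Partition n
complement π = record
  { Block    = λ B → ∃[ A ] (Block π A × B ≡ reflect A)
  ; nonempty = λ { (A , bA , refl) → let i , i∈A = nonempty π bA in
                   opposite i , ∈-reflect⁺ i∈A }
  ; cover    = λ i → let A , bA , i∈A = cover π (opposite i) in
                 reflect A , (A , bA , refl) ,
                 subst (_∈ reflect A) (opposite-involutive i) (∈-reflect⁺ i∈A)
  ; disjoint = λ { (A , bA , refl) (B , bB , refl) i∈A i∈B →
                   cong reflect (disjoint π bA bB
                     (∈-reflect⁻ {A = A} i∈A) (∈-reflect⁻ {A = B} i∈B)) }
  }

SelfComplementary : ∀ {n} → Partition n → Set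
SelfComplementary π = complement π ≈ π

selfComplementaryNoncrossing : ℕ → Setoid (suc 0ℓ) 0ℓ
selfComplementaryNoncrossing n = On.setoid
  {B = Σ (Partition n) λ π → Noncrossing π × SelfComplementary π}
  (partitionSetoid n) proj₁

-- S has exactly k elements up to its equality.
HasCardinality : ∀ {c ℓ} → Setoid c ℓ → ℕ → Set (c ⊔ ℓ)
HasCardinality S k = Bijection (≡.setoid (Fin k)) S

{-# OPTIONS --safe #-}

-- A function H on the times 0, …, 2n partitions [n]: put element i (counted from 0)
-- at time 2i + 1 and let i ~ j when H takes the same value at both times and no
-- smaller value between them. The result is always noncrossing, and it is
-- self-complementary when H t = H (2n - t). If H is a ±1 walk from 0 to 0 that
-- stays nonnegative, H steps up into time 2i + 1 exactly when i is the first element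
-- of its block, and down out of it exactly when i is the last. So H is determined by
-- the partition, and conversely the walk with these steps gives back any noncrossing
-- partition. A symmetric walk is determined by its first half, an arbitrary
-- nonnegative ±1 walk of length n from 0; the reflection principle counts these.
module Submission where

open import Defs
open import Algebra.Properties.CommutativeSemigroup using (interchange)
open import Data.Bool.Base using (Bool; not; if_then_else_)
open import Data.Bool.Properties using () renaming (_≟_ to _≟ᵇ_)
open import Data.Fin.Base as Fin using (Fin; toℕ; fromℕ<; opposite)
open import Data.Fin.Properties
  using (+↔⊎; toℕ<n; toℕ-fromℕ<; toℕ-injective; opposite-prop; opposite-involutive)
open import Data.Fin.Subset using (Subset; _∈_) renaming (⊥ to ∅)
open import Data.Fin.Subset.Properties using (⊆-antisym)
open import Data.Nat.Base
open import Data.Nat.Combinatorics using (_C_; nCk+nC[k+1]≡[n+1]C[k+1])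
open import Data.Nat.Properties
open import Data.Parity.Base using (0ℙ; 1ℙ; _⁻¹)
open import Data.Parity.Properties using (⁻¹-selfInverse; suc-homo-⁻¹)
open import Data.Product.Base using (∃; ∃-syntax; _×_; _,_; proj₁; proj₂; swap)
open import Data.Sum.Base as Sum using (_⊎_; inj₁; inj₂)
open import Data.Sum.Function.Propositional using (_⊎-↔_)
open import Data.Vec.Base using (tabulate)
open import Data.Vec.Properties
  using (lookup∘tabulate; tabulate-cong; []=⇒lookup; lookup⇒[]=; ≡-dec)
open import Function.Base using (_∘_)
open import Function.Bundles using (_⇔_; mk⇔; Equivalence; _↔_; mk↔ₛ′; Inverse; Injection)
open import Function.Construct.Composition using (_↔-∘_)
open import Function.Construct.Identity using (⇔-id)
open import Function.Construct.Symmetry using (⇔-sym)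
open import Function.Properties.Inverse using (↔⇒↣)
open import Level using (0ℓ)
open import Relation.Binary.Core using (Rel)
open import Relation.Binary.Definitions using (DecidableEquality; tri<; tri≈; tri>)
open import Relation.Binary.PropositionalEquality hiding (isDecEquivalence)
open import Relation.Binary.Structures using (IsDecEquivalence)
open import Relation.Nullary using (¬_; Dec; yes; no; does; contradiction)
open import Relation.Nullary.Decidable
  using (_×-dec_; _→-dec_; map′; dec-true; dec-false; does-⇔; decidable-stable)

-- Counting walks

-- The second index is the starting height; `down` requires it to be positive, so paths stay
-- nonnegative. The end height is free, as for the first half of a symmetric walk.
data Path : ℕ → ℕ → Set where
  []   : ∀ {h} → Path 0 h
  up   : ∀ {n h} → Path n (suc h) → Path (suc n) h
  down : ∀ {n h} → Path n h → Path (suc n) (suc h)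

#Path : ℕ → ℕ → ℕ
#Path zero    h       = 1
#Path (suc n) zero    = #Path n 1
#Path (suc n) (suc h) = #Path n (2 + h) + #Path n h

enumerate : ∀ n h → Fin (#Path n h) ↔ Path n h
enumerate zero h =
  mk↔ₛ′ (λ _ → []) (λ _ → Fin.zero) (λ { [] → refl }) (λ { Fin.zero → refl ; (Fin.suc ()) })
enumerate (suc n) zero =
  mk↔ₛ′ up (λ { (up p) → p }) (λ { (up p) → refl }) (λ _ → refl) ↔-∘ enumerate n 1
enumerate (suc n) (suc h) =
  mk↔ₛ′ (λ { (inj₁ p) → up p ; (inj₂ p) → down p })
        (λ { (up p) → inj₁ p ; (down p) → inj₂ p })
        (λ { (up p) → refl ; (down p) → refl })
        (λ { (inj₁ p) → refl ; (inj₂ p) → refl })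
  ↔-∘ ((enumerate n (2 + h) ⊎-↔ enumerate n h) ↔-∘ +↔⊎)

∑C< : ℕ → ℕ → ℕ
∑C< n zero    = 0
∑C< n (suc m) = ∑C< n m + n C m

-- The truncation in pred is harmless: both sides vanish at m = 0.
∑C<-pascal : ∀ n m → ∑C< (suc n) m ≡ ∑C< n m + ∑C< n (pred m)
∑C<-pascal n zero = refl
∑C<-pascal n (suc zero) = refl
∑C<-pascal n (suc (suc m)) = begin
  ∑C< (suc n) (suc m) + suc n C suc m
    ≡⟨ cong₂ _+_ (∑C<-pascal n (suc m)) (sym (nCk+nC[k+1]≡[n+1]C[k+1] n m)) ⟩
  (∑C< n (suc m) + ∑C< n m) + (n C m + n C suc m)
    ≡⟨ cong (∑C< n (suc m) + ∑C< n m +_) (+-comm (n C m) _) ⟩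
  (∑C< n (suc m) + ∑C< n m) + (n C suc m + n C m)
    ≡⟨ interchange +-commutativeSemigroup (∑C< n (suc m)) _ _ _ ⟩
  (∑C< n (suc m) + n C suc m) + (∑C< n m + n C m) ∎
  where open ≡-Reasoning

∑C<0 : ∀ m → ∑C< 0 (suc m) ≡ 1
∑C<0 zero = refl
∑C<0 (suc m) = trans (+-identityʳ _) (∑C<0 m)

-- The reflection principle: the walks of length n from h that stay nonnegative
-- are as many as the walks with m ∸ h to m down steps, m = ⌊ (n + h) / 2 ⌋.
#Path-∑ : ∀ n h → let m = ⌊ n + h /2⌋ in #Path n h + ∑C< n (m ∸ h) ≡ ∑C< n (suc m)
#Path-∑ zero h = begin
  1 + ∑C< 0 (⌊ h /2⌋ ∸ h)  ≡⟨ cong (λ k → 1 + ∑C< 0 k) (m≤n⇒m∸n≡0 (⌊n/2⌋≤n h)) ⟩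
  1                        ≡⟨ ∑C<0 ⌊ h /2⌋ ⟨
  ∑C< 0 (suc ⌊ h /2⌋)      ∎
  where open ≡-Reasoning
#Path-∑ (suc n) zero
  with #Path-∑ n 1
... | ih rewrite +-identityʳ n | +-comm n 1 = begin
  #Path n 1 + ∑C< (suc n) m
    ≡⟨ cong (#Path n 1 +_) (trans (∑C<-pascal n m) (+-comm (∑C< n m) _)) ⟩
  #Path n 1 + (∑C< n (pred m) + ∑C< n m)
    ≡⟨ +-assoc (#Path n 1) _ _ ⟨
  #Path n 1 + ∑C< n (pred m) + ∑C< n m
    ≡⟨ cong (λ k → #Path n 1 + ∑C< n k + ∑C< n m) (pred[m∸n]≡m∸[1+n] m 0) ⟩
  #Path n 1 + ∑C< n (m ∸ 1) + ∑C< n m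
    ≡⟨ cong (_+ ∑C< n m) ih ⟩
  ∑C< n (suc m) + ∑C< n m
    ≡⟨ ∑C<-pascal n (suc m) ⟨
  ∑C< (suc n) (suc m) ∎
  where
  open ≡-Reasoning
  m = ⌊ suc n /2⌋
#Path-∑ (suc n) (suc h)
  with #Path-∑ n (2 + h) | #Path-∑ n h
-- The goal and the case `2 + h` have midpoint `suc m`, the case `h` has midpoint `m`; after
-- Pascal's rule each hypothesis absorbs one of the two sums.
... | ih₁ | ih₂ rewrite +-suc n (suc h) | +-suc n h = begin
  (a + b) + ∑C< (suc n) (m ∸ h)
    ≡⟨ cong (a + b +_) (trans (∑C<-pascal n (m ∸ h)) (+-comm (∑C< n (m ∸ h)) _)) ⟩
  (a + b) + (∑C< n (pred (m ∸ h)) + ∑C< n (m ∸ h))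
    ≡⟨ cong (λ k → (a + b) + (∑C< n k + ∑C< n (m ∸ h))) (pred[m∸n]≡m∸[1+n] m h) ⟩
  (a + b) + (∑C< n (m ∸ suc h) + ∑C< n (m ∸ h))
    ≡⟨ interchange +-commutativeSemigroup a b _ _ ⟩
  (a + ∑C< n (m ∸ suc h)) + (b + ∑C< n (m ∸ h))
    ≡⟨ cong₂ _+_ ih₁ ih₂ ⟩
  ∑C< n (2 + m) + ∑C< n (suc m)
    ≡⟨ ∑C<-pascal n (2 + m) ⟨
  ∑C< (suc n) (2 + m) ∎
  where
  open ≡-Reasoning
  m = ⌊ n + h /2⌋
  a = #Path n (2 + h)
  b = #Path n h

-- At starting height 0 the two sums in `#Path-∑` differ by one term, the central binomial
-- coefficient.
#Path-C : ∀ n → #Path n 0 ≡ n C ⌊ n /2⌋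
#Path-C n with #Path-∑ n 0
... | eq rewrite +-identityʳ n =
  +-cancelʳ-≡ (∑C< n ⌊ n /2⌋) _ _ (trans eq (+-comm (∑C< n ⌊ n /2⌋) _))

C↔Path : ∀ n → Fin (n C ⌊ n /2⌋) ↔ Path n 0
C↔Path n = subst (λ k → Fin k ↔ Path n 0) (#Path-C n) (enumerate n 0)

-- Walks and level sets

-- Unlike `n + n`, `double (suc i)` computes to two successors, so the time after `pos i` is
-- `double (suc i)` by definition.
double : ℕ → ℕ
double zero    = zero
double (suc i) = suc (suc (double i))

double-mono-≤ : ∀ {i j} → i ≤ j → double i ≤ double j
double-mono-≤ z≤n       = z≤n
double-mono-≤ (s≤s i≤j) = s≤s (s≤s (double-mono-≤ i≤j))

double-cancel-< : ∀ {i j} → double i < double j → i < j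
double-cancel-< {zero}  {suc j} _             = z<s
double-cancel-< {suc i} {suc j} (s≤s (s≤s p)) = s<s (double-cancel-< p)

double-+ : ∀ i j → double (i + j) ≡ double i + double j
double-+ zero    j = refl
double-+ (suc i) j = cong (suc ∘ suc) (double-+ i j)

double≡n+n : ∀ n → double n ≡ n + n
double≡n+n zero    = refl
double≡n+n (suc n) = cong suc (trans (cong suc (double≡n+n n)) (sym (+-suc n n)))

n≤double : ∀ n → n ≤ double n
n≤double n = subst (n ≤_) (sym (double≡n+n n)) (m≤m+n n n)

double-or-suc : ∀ t → (∃ λ i → t ≡ double i) ⊎ (∃ λ i → t ≡ suc (double i))
double-or-suc zero = inj₁ (0 , refl)
double-or-suc (suc t) with double-or-suc t
... | inj₁ (i , refl) = inj₂ (i , refl)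
... | inj₂ (i , refl) = inj₁ (suc i , refl)

parity-double : ∀ i → parity (double i) ≡ 0ℙ
parity-double zero    = refl
parity-double (suc i) = parity-double i

parity-suc-double : ∀ i → parity (suc (double i)) ≡ 1ℙ
parity-suc-double zero    = refl
parity-suc-double (suc i) = parity-suc-double i

Step : ℕ → ℕ → Set
Step a b = b ≡ suc a ⊎ a ≡ suc b

parity-step : ∀ {a b} → Step a b → parity a ⁻¹ ≡ parity b
parity-step {a} (inj₁ refl) = ⁻¹-selfInverse (suc-homo-⁻¹ a)
parity-step {b = b} (inj₂ refl) = suc-homo-⁻¹ b

step-unique : ∀ {a a′ b b′} → a ≡ a′ → Step a b → Step a′ b′ →
  (a ≡ suc b → b′ ≢ suc a′) → (b ≡ suc a → a′ ≢ suc b′) → b ≡ b′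
step-unique refl (inj₁ rise) (inj₁ rise′) _ _ = trans rise (sym rise′)
step-unique refl (inj₂ fall) (inj₂ fall′) _ _ = suc-injective (trans (sym fall) fall′)
step-unique refl (inj₁ rise) (inj₂ fall)  _ g = contradiction fall (g rise)
step-unique refl (inj₂ fall) (inj₁ rise)  f _ = contradiction rise (f fall)

height : ∀ {n h} → Path n h → ℕ → ℕ
height {h = h} p        zero    = h
height {h = h} []       (suc t) = h
height         (up p)   (suc t) = height p t
height         (down p) (suc t) = height p t

height-step : ∀ {n h} (p : Path n h) {t} → t < n → Step (height p t) (height p (suc t))
height-step (up p)   {zero}  _   = inj₁ refl
height-step (down p) {zero}  _   = inj₂ refl
height-step (up p)   {suc t} t<n = height-step p (s<s⁻¹ t<n)
height-step (down p) {suc t} t<n = height-step p (s<s⁻¹ t<n)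

height-injective : ∀ {n h} (p q : Path n h) → (∀ {t} → t ≤ n → height p t ≡ height q t) → p ≡ q
height-injective []       []       eq = refl
height-injective (up p)   (up q)   eq = cong up (height-injective p q (eq ∘ s≤s))
height-injective (down p) (down q) eq = cong down (height-injective p q (eq ∘ s≤s))
height-injective (up p)   (down q) eq = contradiction (sym (eq (s≤s z≤n))) (m≢1+n+m _)
height-injective (down p) (up q)   eq = contradiction (eq (s≤s z≤n)) (m≢1+n+m _)

prepend : ∀ {n h h′} → Step h h′ → Path n h′ → Path (suc n) h
prepend (inj₁ refl) p = up p
prepend (inj₂ refl) p = down p

height-prepend : ∀ {n h h′} (s : Step h h′) (p : Path n h′) t →
  height (prepend s p) (suc t) ≡ height p t
height-prepend (inj₁ refl) p t = refl
height-prepend (inj₂ refl) p t = refl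

-- Nonnegativity comes from the type of the heights: a fall to a natural number starts at a
-- successor.
fromHeights : ∀ n (H : ℕ → ℕ) → (∀ {t} → t < n → Step (H t) (H (suc t))) →
  ∃ λ (p : Path n (H 0)) → ∀ {t} → t ≤ n → height p t ≡ H t
fromHeights zero    H step = [] , λ { z≤n → refl }
fromHeights (suc n) H step with fromHeights n (H ∘ suc) (step ∘ s<s)
... | p , eq = prepend (step z<s) p , λ
  { {zero}  _         → refl
  ; {suc t} (s≤s t≤n) → trans (height-prepend (step z<s) p t) (eq t≤n)
  }

-- The equation `suc (i + i′) ≡ n` expresses that `i` and `i′`, counted from 0, are mirror images; a
-- sum avoids truncated subtraction.
mirror-< : ∀ {n} i i′ → suc (i + i′) ≡ n → i < n
mirror-< i i′ refl = s≤s (m≤m+n i i′)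

mirror-sym : ∀ {n} i i′ → suc (i + i′) ≡ n → suc (i′ + i) ≡ n
mirror-sym i i′ refl = cong suc (+-comm i′ i)

mirror-∸ : ∀ {n} i i′ → suc (i + i′) ≡ n → n ∸ suc i ≡ i′
mirror-∸ i i′ refl = m+n∸m≡n i i′

-- This and the next two bounds drive inductions on a bound `ℓ` for the length of an interval:
-- raising the left end or lowering the right end uses up one unit.
≤+suc⇒≤ : ∀ {i j k ℓ} → j ≤ i + suc ℓ → i < k → j ≤ k + ℓ
≤+suc⇒≤ {i} {ℓ = ℓ} j≤ i<k = ≤-trans j≤ (≤-trans (≤-reflexive (+-suc i ℓ)) (+-monoˡ-≤ ℓ i<k))

≤+suc⇒<⇒≤ : ∀ {i j k ℓ} → j ≤ i + suc ℓ → k < j → k ≤ i + ℓ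
≤+suc⇒<⇒≤ {i} {ℓ = ℓ} j≤ k<j = s≤s⁻¹ (≤-trans k<j (≤-trans j≤ (≤-reflexive (+-suc i ℓ))))

≤+0⇒≮ : ∀ {i j} → j ≤ i + 0 → ¬ i < j
≤+0⇒≮ {i} j≤ i<j = <⇒≱ i<j (≤-trans j≤ (≤-reflexive (+-identityʳ i)))

-- Element i sits at time 2 i + 1 of a walk of length 2 n.
pos : ℕ → ℕ
pos i = suc (double i)

pos-mono-≤ : ∀ {i j} → i ≤ j → pos i ≤ pos j
pos-mono-≤ = s≤s ∘ double-mono-≤

pos<double : ∀ {i n} → i < n → pos i < double n
pos<double = double-mono-≤

module _ (H : ℕ → ℕ) where

  Level : ℕ → ℕ → Set
  Level s e = H s ≡ H e × (∀ {t} → s ≤ t → t ≤ e → H s ≤ H t)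

  -- For `s > e` the second part of `Level s e` is vacuous. Asking for both directions makes the
  -- relation symmetric without cases on the order of `i` and `j`.
  SameBlock : ℕ → ℕ → Set
  SameBlock i j = Level (pos i) (pos j) × Level (pos j) (pos i)

module _ {H : ℕ → ℕ} where

  level-refl : ∀ {s} → Level H s s
  level-refl = refl , λ s≤t t≤s → ≤-reflexive (cong H (≤-antisym s≤t t≤s))

  -- Whatever the order of `s`, `m` and `e`, a time between `s` and `e` is at most `m` or at least
  -- `m`, and one of the two levels covers it.
  level-trans : ∀ {s m e} → Level H s m → Level H m e → Level H s e
  level-trans {s} {m} {e} (eq , low) (eq′ , low′) = trans eq eq′ , lem
    where
    lem : ∀ {t} → s ≤ t → t ≤ e → H s ≤ H t
    lem {t} s≤t t≤e with ≤-total t m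
    ... | inj₁ t≤m = low s≤t t≤m
    ... | inj₂ m≤t = ≤-trans (≤-reflexive eq) (low′ m≤t t≤e)

  level-flip : ∀ {s e} → s ≤ e → Level H s e → Level H e s
  level-flip s≤e (eq , low) = sym eq , λ e≤t t≤s →
    ≤-trans (≤-reflexive (sym eq)) (low (≤-trans s≤e e≤t) (≤-trans t≤s s≤e))

  level-prefix : ∀ {s m e} → m ≤ e → H s ≡ H m → Level H s e → Level H s m
  level-prefix m≤e eq (_ , low) = eq , λ s≤t t≤m → low s≤t (≤-trans t≤m m≤e)

  level-suffix : ∀ {s m e} → s ≤ m → H m ≡ H e → Level H s e → Level H m e
  level-suffix s≤m eq (eq′ , low) = eq , λ m≤t t≤e →
    ≤-trans (≤-reflexive (trans eq (sym eq′))) (low (≤-trans s≤m m≤t) t≤e)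

  -- The fall is given by `pred` because `FirstLastWalk` applies this before positivity is known.
  -- Here `H e` is `suc (H s)`, so nothing is truncated.
  level-enclose : ∀ {s e} → H (suc s) ≡ suc (H s) → H (suc e) ≡ pred (H e) →
    Level H (suc s) e → Level H s (suc e)
  level-enclose {s} {e} rise fall (eq , low) = eq′ , lem
    where
    eq′ : H s ≡ H (suc e)
    eq′ = sym (trans fall (cong pred (trans (sym eq) rise)))
    lem : ∀ {t} → s ≤ t → t ≤ suc e → H s ≤ H t
    lem s≤t t≤1+e with m≤n⇒m<n∨m≡n s≤t | m≤n⇒m<n∨m≡n t≤1+e
    ... | inj₂ refl | _         = ≤-refl
    ... | inj₁ _    | inj₂ refl = ≤-reflexive eq′
    ... | inj₁ s<t  | inj₁ t<e  =
      ≤-trans (n≤1+n _) (≤-trans (≤-reflexive (sym rise)) (low s<t (s≤s⁻¹ t<e)))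

  level? : ∀ s e → Dec (Level H s e)
  level? s e = H s ≟ H e ×-dec
    map′ (λ f {_} s≤t t≤e → f (s≤s t≤e) s≤t) (λ f {_} t<1+e s≤t → f s≤t (s≤s⁻¹ t<1+e))
         (allUpTo? (λ t → s ≤? t →-dec H s ≤? H t) (suc e))

  sameBlock? : ∀ i j → Dec (SameBlock H i j)
  sameBlock? i j = level? (pos i) (pos j) ×-dec level? (pos j) (pos i)

  sameBlock-refl : ∀ {i} → SameBlock H i i
  sameBlock-refl = level-refl , level-refl

  sameBlock-sym : ∀ {i j} → SameBlock H i j → SameBlock H j i
  sameBlock-sym = swap

  sameBlock-trans : ∀ {i j k} → SameBlock H i j → SameBlock H j k → SameBlock H i k
  sameBlock-trans (l , l′) (m , m′) = level-trans l m , level-trans m′ l′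

  level⇒sameBlock : ∀ {i j} → i ≤ j → Level H (pos i) (pos j) → SameBlock H i j
  level⇒sameBlock i≤j l = l , level-flip (pos-mono-≤ i≤j) l

  -- The level of `a` and `c` is at most the height at `b`, and the level of `b` and `d` is at most
  -- the height at `c`, so the two levels coincide.
  sameBlock-noncrossing : ∀ {a b c d} → a < b → b < c → c < d →
    SameBlock H a c → SameBlock H b d → SameBlock H a b
  sameBlock-noncrossing {a} {b} {c} {d} a<b b<c c<d (ac@(eq , low) , _) ((_ , low′) , _) =
    level⇒sameBlock (<⇒≤ a<b) (level-prefix b≤c Ha≡Hb ac)
    where
    a≤b = pos-mono-≤ (<⇒≤ a<b)
    b≤c = pos-mono-≤ (<⇒≤ b<c)
    c≤d = pos-mono-≤ (<⇒≤ c<d)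
    Ha≡Hb = ≤-antisym (low a≤b b≤c) (≤-trans (low′ b≤c c≤d) (≤-reflexive (sym eq)))

level-cong : ∀ {H K N s e} → (∀ {t} → t ≤ N → H t ≡ K t) → s ≤ N → e ≤ N →
  Level H s e → Level K s e
level-cong eq s≤N e≤N (l , low) =
  trans (sym (eq s≤N)) (trans l (eq e≤N)) ,
  λ s≤t t≤e → subst₂ _≤_ (eq s≤N) (eq (≤-trans t≤e e≤N)) (low s≤t t≤e)

sameBlock-cong : ∀ {H K n i j} → (∀ {t} → t ≤ double n → H t ≡ K t) → i < n → j < n →
  SameBlock H i j → SameBlock K i j
sameBlock-cong eq i<n j<n (l , l′) = level-cong eq i≤ j≤ l , level-cong eq j≤ i≤ l′
  where
  i≤ = <⇒≤ (pos<double i<n)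
  j≤ = <⇒≤ (pos<double j<n)

pos-mirror : ∀ {n i i′} → suc (i + i′) ≡ n → pos i + pos i′ ≡ double n
pos-mirror {i = i} {i′} refl =
  cong suc (trans (+-suc (double i) (double i′)) (cong suc (sym (double-+ i i′))))

double-mirror : ∀ {n i i′} → suc (i + i′) ≡ n → double i + suc (pos i′) ≡ double n
double-mirror {i = i} {i′} refl = trans (+-suc (double i) (pos i′)) (pos-mirror {i = i} refl)

-- Symmetric walks and their uniqueness

record SymmetricWalk (n : ℕ) (H : ℕ → ℕ) : Set where
  field
    start  : H 0 ≡ 0
    step   : ∀ {t} → t < double n → Step (H t) (H (suc t))
    mirror : ∀ {s t} → s + t ≡ double n → H s ≡ H t

  -- Every step flips the parity of both height and time. This tells the elements, at odd times,
  -- from the even times between them.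
  parity-height : ∀ {t} → t ≤ double n → parity (H t) ≡ parity t
  parity-height {zero}  _    = cong parity start
  parity-height {suc t} t<2n = trans (sym (parity-step (step t<2n)))
    (trans (cong _⁻¹ (parity-height (<⇒≤ t<2n))) (⁻¹-selfInverse (suc-homo-⁻¹ t)))

  -- A discrete intermediate value argument: going back from `m`, the height changes by one at a
  -- time and must pass `v` on its way to 0.
  last-visit : ∀ {v m} → v < H m → m ≤ double n →
    ∃ λ t → t < m × H t ≡ v × (∀ {s} → t ≤ s → s ≤ m → v ≤ H s)
  last-visit {v} {zero} v<H _ rewrite start = contradiction v<H λ ()
  last-visit {v} {suc m} v<H m<2n with m≤n⇒m<n∨m≡n v≤Hm
    where
    v≤Hm : v ≤ H m
    v≤Hm with step m<2n
    ... | inj₁ rise = s≤s⁻¹ (subst (v <_) rise v<H)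
    ... | inj₂ fall = ≤-trans (<⇒≤ v<H) (≤-trans (n≤1+n _) (≤-reflexive (sym fall)))
  ... | inj₂ refl = m , ≤-refl , refl , lem
    where
    lem : ∀ {s} → m ≤ s → s ≤ suc m → H m ≤ H s
    lem m≤s s≤1+m with m≤n⇒m<n∨m≡n s≤1+m
    ... | inj₁ s<1+m = ≤-reflexive (cong H (≤-antisym m≤s (s≤s⁻¹ s<1+m)))
    ... | inj₂ refl  = <⇒≤ v<H
  ... | inj₁ v<Hm with last-visit v<Hm (<⇒≤ m<2n)
  ... | t , t<m , Ht≡v , low = t , m<n⇒m<1+n t<m , Ht≡v , lem
    where
    lem : ∀ {s} → t ≤ s → s ≤ suc m → v ≤ H s
    lem t≤s s≤1+m with m≤n⇒m<n∨m≡n s≤1+m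
    ... | inj₁ s<1+m = low t≤s (s≤s⁻¹ s<1+m)
    ... | inj₂ refl  = <⇒≤ v<H

  -- The last visit before time `double i` to the height reached by the fall happens at an odd time,
  -- by parity, so it is the position of a block mate.
  fall⇒earlier : ∀ {i} → i < n → H (double i) ≡ suc (H (pos i)) → ∃ λ j → j < i × SameBlock H j i
  fall⇒earlier {i} i<n fall
    with last-visit {H (pos i)} (≤-reflexive (sym fall)) (<⇒≤ (<⇒≤ (pos<double i<n)))
  ... | t , t<2i , Ht≡ , low with double-or-suc t
  ... | inj₁ (j , refl) = contradiction 0ℙ≡1ℙ λ ()
    where
    open ≡-Reasoning
    i≤2n = <⇒≤ (pos<double i<n)
    0ℙ≡1ℙ = begin
      0ℙ                  ≡⟨ parity-double j ⟨
      parity (double j)   ≡⟨ parity-height (≤-trans (<⇒≤ t<2i) (<⇒≤ i≤2n)) ⟨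
      parity (H (double j)) ≡⟨ cong parity Ht≡ ⟩
      parity (H (pos i))  ≡⟨ parity-height i≤2n ⟩
      parity (pos i)      ≡⟨ parity-suc-double i ⟩
      1ℙ                  ∎
  ... | inj₂ (j , refl) = j , j<i , level⇒sameBlock (<⇒≤ j<i) (Ht≡ , lem)
    where
    j<i = double-cancel-< (<⇒≤ t<2i)
    lem : ∀ {s} → pos j ≤ s → s ≤ pos i → H (pos j) ≤ H s
    lem j≤s s≤i with m≤n⇒m<n∨m≡n s≤i
    ... | inj₁ s<i  = ≤-trans (≤-reflexive Ht≡) (low j≤s (s≤s⁻¹ s<i))
    ... | inj₂ refl = ≤-reflexive Ht≡

  -- A rise would put the height at time `double i`, which lies between `pos j` and `pos i`, below
  -- their common level.
  earlier⇒¬rise : ∀ {i j} → j < i → SameBlock H j i → H (pos i) ≢ suc (H (double i))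
  earlier⇒¬rise {i} j<i ((eq , low) , _) rise = <⇒≱ (≤-reflexive (sym rise))
    (≤-trans (≤-reflexive (sym eq)) (low (<⇒≤ (double-mono-≤ j<i)) (n≤1+n _)))

  level-mirror : ∀ {s s′ e e′} → s + s′ ≡ double n → e + e′ ≡ double n → Level H s e → Level H e′ s′
  level-mirror {s} {s′} {e} {e′} s+s′ e+e′ (eq , low) = eq′ , lem
    where
    eq′ : H e′ ≡ H s′
    eq′ = trans (sym (mirror e+e′)) (trans (sym eq) (mirror s+s′))
    lem : ∀ {t} → e′ ≤ t → t ≤ s′ → H e′ ≤ H t
    lem {t} e′≤t t≤s′ = begin
      H e′ ≡⟨ mirror e+e′ ⟨
      H e  ≡⟨ eq ⟨
      H s  ≤⟨ low (subst (_≤ t′) (m+n≡o⇒o∸n≡m s+s′) (∸-monoʳ-≤ (double n) t≤s′))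
                  (subst (t′ ≤_) (m+n≡o⇒o∸n≡m e+e′) (∸-monoʳ-≤ (double n) e′≤t)) ⟩
      H t′ ≡⟨ mirror (m∸n+n≡m (≤-trans t≤s′ (subst (s′ ≤_) s+s′ (m≤n+m s′ s)))) ⟩
      H t  ∎
      where
      open ≤-Reasoning
      t′ = double n ∸ t
      m+n≡o⇒o∸n≡m : ∀ {m n o} → m + n ≡ o → o ∸ n ≡ m
      m+n≡o⇒o∸n≡m {m} {n} refl = m+n∸n≡m m n

  sameBlock-mirror : ∀ {i i′ j j′} → suc (i + i′) ≡ n → suc (j + j′) ≡ n →
    SameBlock H i j → SameBlock H i′ j′
  sameBlock-mirror {i} {i′} {j} {j′} p q (l , l′) =
    level-mirror (pos-mirror {i = j} q) (pos-mirror {i = i} p) l′ ,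
    level-mirror (pos-mirror {i = i} p) (pos-mirror {i = j} q) l

module _ {n H K} (wH : SymmetricWalk n H) (wK : SymmetricWalk n K)
         (same : ∀ {i j} → i < n → j < n → SameBlock H i j → SameBlock K i j) where
  private
    module H = SymmetricWalk wH
    module K = SymmetricWalk wK

  ¬fall-rise : ∀ {i} → i < n → H (double i) ≡ suc (H (pos i)) → K (pos i) ≢ suc (K (double i))
  ¬fall-rise i<n fall with H.fall⇒earlier i<n fall
  ... | j , j<i , r = K.earlier⇒¬rise j<i (same (<-trans j<i i<n) i<n r)

  -- Reflection turns the step out of `pos i` into the reversed step into `pos i′`, which reduces
  -- the claim to `¬fall-rise` at `i′`.
  ¬rise-fall : ∀ {i i′} → suc (i + i′) ≡ n →
    H (suc (pos i)) ≡ suc (H (pos i)) → K (pos i) ≢ suc (K (suc (pos i)))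
  ¬rise-fall {i} {i′} p rise fall = ¬fall-rise i′<n
    (trans (H.mirror m₂) (trans rise (cong suc (sym (H.mirror m₁)))))
    (trans (K.mirror m₁) (trans fall (cong suc (sym (K.mirror m₂)))))
    where
    m₁ = trans (+-comm (pos i′) (pos i)) (pos-mirror {i = i} p)
    p′ = mirror-sym i i′ p
    m₂ = double-mirror {i = i′} p′
    i′<n = mirror-< i′ i p′

module _ {n H K} (wH : SymmetricWalk n H) (wK : SymmetricWalk n K)
         (same  : ∀ {i j} → i < n → j < n → SameBlock H i j → SameBlock K i j)
         (same′ : ∀ {i j} → i < n → j < n → SameBlock K i j → SameBlock H i j) where
  private
    module H = SymmetricWalk wH
    module K = SymmetricWalk wK

  walk-unique : ∀ {t} → t ≤ double n → H t ≡ K t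
  walk-unique {zero} _ = trans H.start (sym K.start)
  walk-unique {suc t} t<2n with double-or-suc t
  ... | inj₁ (i , refl) = step-unique (walk-unique (<⇒≤ t<2n)) (H.step t<2n) (K.step t<2n)
    (¬fall-rise wH wK same i<n) (λ rise fall → ¬fall-rise wK wH same′ i<n fall rise)
    where i<n = double-cancel-< t<2n
  ... | inj₂ (i , refl) = step-unique (walk-unique (<⇒≤ t<2n)) (H.step t<2n) (K.step t<2n)
    (λ fall rise → ¬rise-fall wK wH same′ i-mirror rise fall) (¬rise-fall wH wK same i-mirror)
    where i-mirror = m+[n∸m]≡n (double-cancel-< (<⇒≤ t<2n))

-- Extends the first half of a walk by reflecting time at `n`: the minimum never exceeds `n`.
fold : ℕ → (ℕ → ℕ) → ℕ → ℕ
fold n H t = H (t ⊓ (double n ∸ t))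

fold-low : ∀ n H {t} → t ≤ n → fold n H t ≡ H t
fold-low n H {t} t≤n = cong H (m≤n⇒m⊓n≡m (m+n≤o⇒m≤o∸n t
  (subst (t + t ≤_) (sym (double≡n+n n)) (+-mono-≤ t≤n t≤n))))

fold-mirror : ∀ n H s t → s + t ≡ double n → fold n H s ≡ fold n H t
fold-mirror n H s t s+t = cong H (begin
  s ⊓ (double n ∸ s) ≡⟨ cong (s ⊓_) (trans (cong (_∸ s) (sym s+t)) (m+n∸m≡n s t)) ⟩
  s ⊓ t              ≡⟨ ⊓-comm s t ⟩
  t ⊓ s              ≡⟨ cong (t ⊓_) (trans (cong (_∸ t) (sym s+t)) (m+n∸n≡m s t)) ⟨
  t ⊓ (double n ∸ t) ∎)
  where open ≡-Reasoning

fold-walk : ∀ {n} (p : Path n 0) → SymmetricWalk n (fold n (height p))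
fold-walk {n} p = record { start = refl ; step = step ; mirror = λ {s} {t} → mir s t }
  where
  K = fold n (height p)
  mir : ∀ s t → s + t ≡ double n → K s ≡ K t
  mir = fold-mirror n (height p)
  low : ∀ {t} → t < n → Step (K t) (K (suc t))
  low t<n = subst₂ Step (sym (fold-low n (height p) (<⇒≤ t<n))) (sym (fold-low n (height p) t<n))
    (height-step p t<n)
  step : ∀ {t} → t < double n → Step (K t) (K (suc t))
  step {t} t<2n with t <? n
  ... | yes t<n = low t<n
  -- In the second half, the step from `t` is the step from its mirror time `t′` read backwards.
  ... | no t≮n = subst₂ Step
    (mir (suc t′) t (trans (+-comm (suc t′) t) (trans (+-suc t t′) 1+t+t′)))
    (mir t′ (suc t) (trans (+-comm t′ (suc t)) 1+t+t′))
    (Sum.swap (low t′<n))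
    where
    t′ = double n ∸ suc t
    1+t+t′ : suc t + t′ ≡ double n
    1+t+t′ = m+[n∸m]≡n t<2n
    t′<n : t′ < n
    t′<n = +-cancelˡ-< n t′ n
      (subst (n + t′ <_) (trans 1+t+t′ (double≡n+n n)) (s≤s (+-monoˡ-≤ t′ (≮⇒≥ t≮n))))

-- The walk of a noncrossing partition

alternate : (ℕ → Bool) → (ℕ → Bool) → ℕ → Bool
alternate f g zero    = f 0
alternate f g (suc t) = alternate g (f ∘ suc) t

alternate-even : ∀ f g i → alternate f g (double i) ≡ f i
alternate-even f g zero    = refl
alternate-even f g (suc i) = alternate-even (f ∘ suc) (g ∘ suc) i

alternate-odd : ∀ f g i → alternate f g (pos i) ≡ g i
alternate-odd f g = alternate-even g (f ∘ suc)

-- The partition enters as a labelling of naturals, equal labels below `n` meaning the same block;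
-- this keeps the arithmetic out of `Fin`.
module FirstLastWalk {a} {L : Set a} (_≟ᴸ_ : DecidableEquality L) (n : ℕ) (f : ℕ → L)
  (noncrossing : ∀ {a b c d} → a < b → b < c → c < d → d < n →
                 f a ≡ f c → f b ≡ f d → f a ≡ f b)
  (symmetric : ∀ {i i′ j j′} → suc (i + i′) ≡ n → suc (j + j′) ≡ n → f i ≡ f j → f i′ ≡ f j′)
  where

  Earlier Later : ℕ → Set a
  Earlier i = ∃ λ j → j < i × f j ≡ f i
  Later i   = ∃ λ j → j < n × i < j × f j ≡ f i

  earlier? : ∀ i → Dec (Earlier i)
  earlier? i = anyUpTo? (λ j → f j ≟ᴸ f i) i

  later? : ∀ i → Dec (Later i)
  later? i = anyUpTo? (λ j → i <? j ×-dec f j ≟ᴸ f i) n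

  isFirst isNonlast : ℕ → Bool
  isFirst i   = not (does (earlier? i))
  isNonlast i = does (later? i)

  rises : ℕ → Bool
  rises = alternate isFirst isNonlast

  -- Falls use `pred`, since only `H-pos>0` will show that no fall before time `double n` is
  -- truncated.
  H : ℕ → ℕ
  H zero    = 0
  H (suc t) = if rises t then suc (H t) else pred (H t)

  H-suc : ∀ t {b} → rises t ≡ b → H (suc t) ≡ (if b then suc (H t) else pred (H t))
  H-suc t = cong (if_then suc (H t) else pred (H t))

  first-rises : ∀ {i} → ¬ Earlier i → H (pos i) ≡ suc (H (double i))
  first-rises {i} ¬e = H-suc (double i)
    (trans (alternate-even isFirst isNonlast i) (cong not (dec-false (earlier? i) ¬e)))

  nonfirst-falls : ∀ {i} → Earlier i → H (pos i) ≡ pred (H (double i))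
  nonfirst-falls {i} e = H-suc (double i)
    (trans (alternate-even isFirst isNonlast i) (cong not (dec-true (earlier? i) e)))

  nonlast-rises : ∀ {i} → Later i → H (double (suc i)) ≡ suc (H (pos i))
  nonlast-rises {i} l = H-suc (pos i)
    (trans (alternate-odd isFirst isNonlast i) (dec-true (later? i) l))

  last-falls : ∀ {i} → ¬ Later i → H (double (suc i)) ≡ pred (H (pos i))
  last-falls {i} ¬l = H-suc (pos i)
    (trans (alternate-odd isFirst isNonlast i) (dec-false (later? i) ¬l))

  first : ∀ ℓ i → i ≤ ℓ → ∃ λ a → a ≤ i × f a ≡ f i × ¬ Earlier a
  first ℓ i i≤ℓ with earlier? i
  first ℓ       i i≤ℓ | no ¬e = i , ≤-refl , refl , ¬e
  first zero    i z≤n | yes (j , () , _)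
  first (suc ℓ) i i≤ℓ | yes (j , j<i , eq) with first ℓ j (s≤s⁻¹ (≤-trans j<i i≤ℓ))
  ... | a , a≤j , eq′ , ¬e = a , ≤-trans a≤j (<⇒≤ j<i) , trans eq′ eq , ¬e

  last : ∀ ℓ i → i < n → n ≤ i + ℓ → ∃ λ m → i ≤ m × m < n × f m ≡ f i × ¬ Later m
  last ℓ i i<n n≤ with later? i
  last ℓ       i i<n n≤ | no ¬l = i , ≤-refl , i<n , refl , ¬l
  last zero    i i<n n≤ | yes (j , j<n , i<j , eq) = contradiction i<n (≤+0⇒≮ n≤)
  last (suc ℓ) i i<n n≤ | yes (j , j<n , i<j , eq)
    with last ℓ j j<n (≤+suc⇒≤ n≤ i<j)
  ... | m , j≤m , m<n , eq′ , ¬l = m , ≤-trans (<⇒≤ i<j) j≤m , m<n , trans eq′ eq , ¬l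

  -- The half-open interval from `a` to `b` is a union of blocks; over it the walk makes an
  -- excursion and returns to its height.
  Saturated : ℕ → ℕ → Set a
  Saturated a b = ∀ {i j} → a ≤ i → i < b → j < n → f i ≡ f j → a ≤ j × j < b

  -- A block sticking out of the gap between consecutive block mates `i` and `j` would cross theirs,
  -- so `k` would belong to their block.
  gap-saturated : ∀ {i j} → i < j → j < n → f i ≡ f j →
    ¬ (∃ λ k → k < j × i < k × f k ≡ f i) → Saturated (suc i) j
  gap-saturated {i} {j} i<j j<n eq none {k} {l} i<k k<j l<n eq′ with <-cmp i l | <-cmp l j
  ... | tri< i<l _ _ | tri< l<j _ _ = i<l , l<j
  ... | tri> _ _ l<i | _ = contradiction
    (k , k<j , i<k , trans eq′ (noncrossing l<i i<k k<j j<n (sym eq′) eq)) none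
  ... | tri≈ _ refl _ | _ = contradiction (k , k<j , i<k , eq′) none
  ... | _ | tri≈ _ refl _ = contradiction (k , k<j , i<k , trans eq′ (sym eq)) none
  ... | _ | tri> _ _ j<l = contradiction
    (k , k<j , i<k , sym (noncrossing i<k k<j j<l l<n eq eq′)) none

  -- Here `m` is the last element of the block of `a`. A block with elements on both sides of `m`
  -- would cross that block or contain an element of it after `m`.
  tail-saturated : ∀ {a m b} → a ≤ m → m < n → f m ≡ f a → ¬ Later m →
    Saturated a b → b ≤ n → Saturated (suc m) b
  tail-saturated {a} {m} a≤m m<n eq ¬l sat b≤n {i} {j} m<i i<b j<n eq′ = m<j , proj₂ both
    where
    both = sat (≤-trans a≤m (<⇒≤ m<i)) i<b j<n eq′
    i<n = <-≤-trans i<b b≤n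
    m<j : m < j
    m<j with <-cmp m j
    ... | tri< m<j _ _ = m<j
    ... | tri≈ _ refl _ = contradiction (i , i<n , m<i , eq′) ¬l
    ... | tri> _ _ j<m with m≤n⇒m<n∨m≡n (proj₁ both)
    ... | inj₂ refl = contradiction (i , i<n , m<i , trans eq′ (sym eq)) ¬l
    ... | inj₁ a<j = contradiction (i , i<n , m<i , trans eq′ (trans (sym a~j) (sym eq))) ¬l
      where a~j = noncrossing a<j j<m m<i i<n (sym eq) (sym eq′)

  -- Induction on a bound ℓ for the length of the interval.
  mutual
    block-level : ∀ ℓ {i j} → i ≤ j → j ≤ i + ℓ → j < n → f i ≡ f j → Level H (pos i) (pos j)
    block-level ℓ {i} {j} i≤j _ _ _ with m≤n⇒m<n∨m≡n i≤j
    block-level ℓ       {i} {j} _ j≤ j<n eq | inj₂ refl = level-refl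
    block-level zero    {i} {j} _ j≤ j<n eq | inj₁ i<j = contradiction i<j (≤+0⇒≮ j≤)
    block-level (suc ℓ) {i} {j} _ j≤ j<n eq | inj₁ i<j
      with anyUpTo? (λ k → i <? k ×-dec f k ≟ᴸ f i) j
    ... | yes (k , k<j , i<k , eq′) = level-trans
      (block-level ℓ (<⇒≤ i<k) (≤+suc⇒<⇒≤ j≤ k<j) (<-trans k<j j<n) (sym eq′))
      (block-level ℓ (<⇒≤ k<j) (≤+suc⇒≤ j≤ i<k) j<n (trans eq′ eq))
    -- Now `i` and `j` are consecutive in their block: a rise out of `i`, an excursion over the
    -- saturated gap, a fall into `j`.
    ... | no none = level-enclose
      (nonlast-rises (j , j<n , i<j , sym eq)) (nonfirst-falls (i , i<j , eq))
      (saturated-level ℓ i<j (≤+suc⇒≤ j≤ ≤-refl) (<⇒≤ j<n) (gap-saturated i<j j<n eq none))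

    saturated-level : ∀ ℓ {a b} → a ≤ b → b ≤ a + ℓ → b ≤ n → Saturated a b →
      Level H (double a) (double b)
    saturated-level ℓ {a} {b} a≤b _ _ _ with m≤n⇒m<n∨m≡n a≤b
    saturated-level ℓ       {a} {b} _ b≤ b≤n sat | inj₂ refl = level-refl
    saturated-level zero    {a} {b} _ b≤ b≤n sat | inj₁ a<b = contradiction a<b (≤+0⇒≮ b≤)
    saturated-level (suc ℓ) {a} {b} _ b≤ b≤n sat | inj₁ a<b
      with last n a (<-≤-trans a<b b≤n) (m≤n+m n a)
    -- The interval splits into the span of the block of `a`, ending at its last element `m`, and a
    -- saturated rest.
    ... | m , a≤m , m<n , eq , ¬l = level-trans
      (level-enclose (first-rises ¬e) (last-falls ¬l)
        (block-level ℓ a≤m (≤+suc⇒<⇒≤ b≤ m<b) m<n (sym eq)))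
      (saturated-level ℓ m<b (≤+suc⇒≤ b≤ (s≤s a≤m)) b≤n
        (tail-saturated a≤m m<n eq ¬l sat b≤n))
      where
      m<b = proj₂ (sat ≤-refl a<b m<n (sym eq))
      ¬e : ¬ Earlier a
      ¬e (j , j<a , eq′) = <⇒≱ j<a (proj₁ (sat ≤-refl a<b j<n (sym eq′)))
        where j<n = <-trans j<a (<-≤-trans a<b b≤n)

  level : ∀ {i j} → i ≤ j → j < n → f i ≡ f j → Level H (pos i) (pos j)
  level {i} {j} i≤j = block-level j i≤j (m≤n+m j i)

  -- All of the elements below `n` form a saturated interval, so the walk returns to 0.
  H-double-n : H (double n) ≡ 0
  H-double-n = sym (proj₁ (saturated-level n z≤n ≤-refl ≤-refl (λ _ _ j<n _ → z≤n , j<n)))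

  -- The height at `i` equals that at the first element of its block, which is entered by a rise.
  H-pos>0 : ∀ {i} → i < n → 0 < H (pos i)
  H-pos>0 {i} i<n with first i i ≤-refl
  ... | a , a≤i , eq , ¬e = subst (0 <_) (trans (sym (first-rises ¬e)) (proj₁ (level a≤i i<n eq))) z<s

  nonfirst-falls′ : ∀ {i} → i < n → Earlier i → H (double i) ≡ suc (H (pos i))
  nonfirst-falls′ i<n e = positive-pred (H-pos>0 i<n) (nonfirst-falls e)
    where
    positive-pred : ∀ {a b} → 0 < a → a ≡ pred b → b ≡ suc a
    positive-pred {b = suc b} _ refl = refl

  last-falls′ : ∀ {i} → i < n → ¬ Later i → H (pos i) ≡ suc (H (double (suc i)))
  last-falls′ i<n ¬l = pred-positive (H-pos>0 i<n) (last-falls ¬l)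
    where
    pred-positive : ∀ {a b} → 0 < b → a ≡ pred b → b ≡ suc a
    pred-positive {b = suc b} _ refl = refl

  H-step : ∀ {t} → t < double n → Step (H t) (H (suc t))
  H-step {t} t<2n with double-or-suc t
  ... | inj₁ (i , refl) with earlier? i
  ...   | yes e = inj₂ (nonfirst-falls′ (double-cancel-< t<2n) e)
  ...   | no ¬e = inj₁ (first-rises ¬e)
  H-step {t} t<2n | inj₂ (i , refl) with later? i
  ...   | yes l = inj₁ (nonlast-rises l)
  ...   | no ¬l = inj₂ (last-falls′ (double-cancel-< (<⇒≤ t<2n)) ¬l)

  module _ {i i′} (i+i′ : suc (i + i′) ≡ n) where
    private
      i<n  = mirror-< i i′ i+i′
      i′+i = mirror-sym i i′ i+i′

    earlier⇒later : Earlier i → Later i′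
    -- The witness `n ∸ suc j` is the mirror image of `j`.
    earlier⇒later (j , j<i , eq) =
      n ∸ suc j , ∸-monoʳ-< z<s j<n , i′<j′ , symmetric (m+[n∸m]≡n j<n) i+i′ eq
      where
      j<n = <-trans j<i i<n
      i′<j′ = subst (_< n ∸ suc j) (mirror-∸ i i′ i+i′) (∸-monoʳ-< (s≤s j<i) i<n)

    later⇒earlier : Later i′ → Earlier i
    later⇒earlier (j , j<n , i′<j , eq) = n ∸ suc j , j′<i , symmetric (m+[n∸m]≡n j<n) i′+i eq
      where
      j′<i = subst (n ∸ suc j <_) (mirror-∸ i′ i i′+i) (∸-monoʳ-< (s≤s i′<j) j<n)

    -- Reflection exchanges first and last elements, so the step into `pos i` is the step out of
    -- `pos i′` reversed.
    H-mirror-step :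
      (H (pos i) ≡ suc (H (double i)) × H (pos i′) ≡ suc (H (double (suc i′)))) ⊎
      (H (double i) ≡ suc (H (pos i)) × H (double (suc i′)) ≡ suc (H (pos i′)))
    H-mirror-step with earlier? i
    ... | yes e = inj₂ (nonfirst-falls′ i<n e , nonlast-rises (earlier⇒later e))
    ... | no ¬e = inj₁ (first-rises ¬e , last-falls′ (mirror-< i′ i i′+i) (¬e ∘ later⇒earlier))

  mutual
    -- From equal heights at times 0 and `double n`, one runner goes forward and the other backward;
    -- `H-mirror-step` makes their moves agree.
    H-mirror-double : ∀ i i′ → i + i′ ≡ n → H (double i) ≡ H (double i′)
    H-mirror-double zero    i′ refl = sym H-double-n
    H-mirror-double (suc i) i′ i+i′
      with H-mirror-pos i i′ i+i′ | H-mirror-step {i′} {i} (mirror-sym i i′ i+i′)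
    ... | eq | inj₁ (rise , fall) = suc-injective (trans (sym fall) (trans eq rise))
    ... | eq | inj₂ (fall , rise) = trans rise (trans (cong suc eq) (sym fall))

    H-mirror-pos : ∀ i i′ → suc (i + i′) ≡ n → H (pos i) ≡ H (pos i′)
    H-mirror-pos i i′ i+i′
      with H-mirror-double i (suc i′) (trans (+-suc i i′) i+i′) | H-mirror-step {i} {i′} i+i′
    ... | eq | inj₁ (rise , fall) = trans rise (trans (cong suc eq) (sym fall))
    ... | eq | inj₂ (fall , rise) = suc-injective (trans (sym fall) (trans eq rise))

  H-mirror : ∀ s t → s + t ≡ double n → H s ≡ H t
  H-mirror s t s+t with double-or-suc s
  ... | inj₁ (i , refl) = trans (H-mirror-double i (n ∸ i) i+i′) (cong H (+-cancelˡ-≡ (double i) _ _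
      (trans (trans (sym (double-+ i (n ∸ i))) (cong double i+i′)) (sym s+t))))
    where
    i+i′ = m+[n∸m]≡n (s≤s⁻¹ (double-cancel-<
      (s≤s (m≤n⇒m≤1+n (subst (double i ≤_) s+t (m≤m+n (double i) t))))))
  ... | inj₂ (i , refl) = trans (H-mirror-pos i (n ∸ suc i) i+i′) (cong H (+-cancelˡ-≡ (pos i) _ _
      (trans (pos-mirror {i = i} i+i′) (sym s+t))))
    where
    i+i′ = m+[n∸m]≡n (double-cancel-< (subst (pos i ≤_) s+t (m≤m+n (pos i) t)))

  walk : SymmetricWalk n H
  walk = record { start = refl ; step = H-step ; mirror = λ {s} {t} → H-mirror s t }

  label⇒sameBlock : ∀ {i j} → i < n → j < n → f i ≡ f j → SameBlock H i j
  label⇒sameBlock {i} {j} i<n j<n eq with ≤-total i j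
  ... | inj₁ i≤j = level⇒sameBlock i≤j (level i≤j j<n eq)
  ... | inj₂ j≤i = sameBlock-sym (level⇒sameBlock j≤i (level j≤i i<n (sym eq)))

  -- If i is not last and j not first, let i′ > i be in the block of i and j′ < j in that of j:
  -- one of them lies between i and j, or j′ < i < j < i′ is a crossing.
  level⇒label : ∀ ℓ {i j} → i ≤ j → j ≤ i + ℓ → j < n → Level H (pos i) (pos j) → f i ≡ f j
  level⇒label ℓ {i} {j} i≤j _ _ _ with m≤n⇒m<n∨m≡n i≤j | f i ≟ᴸ f j
  level⇒label ℓ       _ j≤ j<n l | _         | yes eq = eq
  level⇒label ℓ       _ j≤ j<n l | inj₂ refl | no _   = refl
  level⇒label zero {i} {j} _ j≤ j<n l | inj₁ i<j | no _ = contradiction i<j (≤+0⇒≮ j≤)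
  level⇒label (suc ℓ) {i} {j} _ j≤ j<n l@(eq , low) | inj₁ i<j | no i≁j with later? i | earlier? j
  -- If `i` were last, the walk would drop below the level just after `pos i`; if `j` were first, it
  -- would be below just before `pos j`.
  ... | no ¬l | _ = contradiction (low (n≤1+n _) (m≤n⇒m≤1+n (double-mono-≤ i<j)))
                                  (<⇒≱ (≤-reflexive (sym (last-falls′ (<-trans i<j j<n) ¬l))))
  ... | yes _ | no ¬e = contradiction (low (<⇒≤ (double-mono-≤ i<j)) (n≤1+n _))
                                      (<⇒≱ (≤-reflexive (trans (sym (first-rises ¬e)) (sym eq))))
  ... | yes (i′ , i′<n , i<i′ , eᵢ) | yes (j′ , j′<j , eⱼ) with <-cmp i′ j | <-cmp i j′
  ... | tri≈ _ refl _ | _ = sym eᵢ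
  ... | tri< i′<j _ _ | _ =
    trans (sym eᵢ) (level⇒label ℓ (<⇒≤ i′<j) (≤+suc⇒≤ j≤ i<i′) j<n (level-suffix i≤i′ Hi′≡Hj l))
    where
    i≤i′ = pos-mono-≤ (<⇒≤ i<i′)
    Hi′≡Hj = trans (sym (proj₁ (level (<⇒≤ i<i′) i′<n (sym eᵢ)))) eq
  ... | _ | tri≈ _ refl _ = eⱼ
  ... | _ | tri< i<j′ _ _ =
    trans (level⇒label ℓ (<⇒≤ i<j′) (≤+suc⇒<⇒≤ j≤ j′<j) j′<n (level-prefix j′≤j Hi≡Hj′ l)) eⱼ
    where
    j′<n = <-trans j′<j j<n
    j′≤j = pos-mono-≤ (<⇒≤ j′<j)
    Hi≡Hj′ = trans eq (sym (proj₁ (level (<⇒≤ j′<j) j<n eⱼ)))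
  ... | tri> _ _ j<i′ | tri> _ _ j′<i =
    contradiction (trans (sym (noncrossing j′<i i<j j<i′ i′<n eⱼ (sym eᵢ))) eⱼ) i≁j

  sameBlock⇒label : ∀ {i j} → i < n → j < n → SameBlock H i j → f i ≡ f j
  sameBlock⇒label {i} {j} i<n j<n (l , l′) with ≤-total i j
  ... | inj₁ i≤j = level⇒label j i≤j (m≤n+m j i) j<n l
  ... | inj₂ j≤i = sym (level⇒label i j≤i (m≤n+m i j) i<n l′)

-- Partitions and equivalence relations

module Quotient {n} {_~_ : Rel (Fin n) 0ℓ} (isDecEquivalence : IsDecEquivalence _~_) where
  open IsDecEquivalence isDecEquivalence public
    renaming (_≟_ to _~?_; refl to ~-refl; sym to ~-sym; trans to ~-trans)

  class : Fin n → Subset n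
  class i = tabulate (does ∘ (i ~?_))

  ∈-class⁺ : ∀ {i j} → i ~ j → j ∈ class i
  ∈-class⁺ {i} {j} i~j = lookup⇒[]= j _ (trans (lookup∘tabulate _ j) (dec-true (i ~? j) i~j))

  ∈-class⁻ : ∀ {i j} → j ∈ class i → i ~ j
  ∈-class⁻ {i} {j} j∈ with i ~? j | trans (sym (lookup∘tabulate (does ∘ (i ~?_)) j)) ([]=⇒lookup j∈)
  ... | yes i~j | _  = i~j
  ... | no _    | ()

  class-cong : ∀ {i j} → i ~ j → class i ≡ class j
  class-cong {i} {j} i~j = tabulate-cong λ k →
    does-⇔ (mk⇔ (~-trans (~-sym i~j)) (~-trans i~j)) (i ~? k) (j ~? k)

  partition : Partition n
  partition = record
    { Block    = λ A → ∃[ i ] A ≡ class i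
    ; nonempty = λ { (i , refl) → i , ∈-class⁺ ~-refl }
    ; cover    = λ i → class i , (i , refl) , ∈-class⁺ ~-refl
    ; disjoint = λ { (i , refl) (j , refl) k∈i k∈j →
                     class-cong (~-trans (∈-class⁻ k∈i) (~-sym (∈-class⁻ k∈j))) }
    }

  partition-noncrossing :
    (∀ {a b c d} → a Fin.< b → b Fin.< c → c Fin.< d → a ~ c → b ~ d → a ~ b) →
    Noncrossing partition
  partition-noncrossing nc
    (a , b , c , d , a<b , b<c , c<d ,
     _ , _ , (i , refl) , (j , refl) , A≢B , (a∈ , c∈) , (b∈ , d∈)) =
    A≢B (class-cong (~-trans (∈-class⁻ a∈) (~-trans a~b (~-sym (∈-class⁻ b∈)))))
    where
    a~b : a ~ b
    a~b = nc a<b b<c c<d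
      (~-trans (~-sym (∈-class⁻ a∈)) (∈-class⁻ c∈))
      (~-trans (~-sym (∈-class⁻ b∈)) (∈-class⁻ d∈))

  module _ (symmetric : ∀ {i j} → i ~ j → opposite i ~ opposite j) where

    reflect-class : ∀ i → reflect (class i) ≡ class (opposite i)
    reflect-class i = tabulate-cong λ j → trans (lookup∘tabulate _ (opposite j))
      (does-⇔ (mk⇔ (λ r → subst (opposite i ~_) (opposite-involutive j) (symmetric r))
                   (λ r → subst (_~ opposite j) (opposite-involutive i) (symmetric r)))
              (i ~? opposite j) (opposite i ~? j))

    partition-selfComplementary : SelfComplementary partition
    partition-selfComplementary A = mk⇔
      (λ { (_ , (i , refl) , refl) → opposite i , reflect-class i })
      (λ { (i , refl) → class (opposite i) , (opposite i , refl) ,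
             sym (trans (reflect-class (opposite i)) (cong class (opposite-involutive i))) })

-- The class of `i` under `R` is also the class of some `k` under `S`, and it contains both `i` and
-- `j`.
partition-injective : ∀ {n} {R S : Rel (Fin n) 0ℓ}
  (E : IsDecEquivalence R) (F : IsDecEquivalence S) →
  Quotient.partition E ≈ Quotient.partition F → ∀ {i j} → R i j → S i j
partition-injective {R = R} {S} E F p {i} {j} r
  with Equivalence.to (p (Quotient.class E i)) (i , refl)
... | k , eq = F.~-trans (F.~-sym (lem E.~-refl)) (lem r)
  where
  module E = Quotient E
  module F = Quotient F
  lem : ∀ {l} → R i l → S k l
  lem r = F.∈-class⁻ (subst (_ ∈_) eq (E.∈-class⁺ r))

module Label {n} (π : Partition n) where

  -- `Block π` is an arbitrary predicate, but equality of subsets is decidable, so comparing labels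
  -- decides whether two elements share a block.
  label : Fin n → Subset n
  label i = proj₁ (cover π i)

  label-block : ∀ i → Block π (label i)
  label-block i = proj₁ (proj₂ (cover π i))

  ∈-label : ∀ i → i ∈ label i
  ∈-label i = proj₂ (proj₂ (cover π i))

  block≡label : ∀ {A i} → Block π A → i ∈ A → A ≡ label i
  block≡label {i = i} bA i∈A = disjoint π bA (label-block i) i∈A (∈-label i)

  label-noncrossing : Noncrossing π → ∀ {a b c d} → a Fin.< b → b Fin.< c → c Fin.< d →
    label a ≡ label c → label b ≡ label d → label a ≡ label b
  label-noncrossing nc {a} {b} {c} {d} a<b b<c c<d a~c b~d =
    -- `Noncrossing` is a negation; decidability of label equality recovers the positive conclusion.
    decidable-stable (≡-dec _≟ᵇ_ _ _) λ a≁b →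
    nc (a , b , c , d , a<b , b<c , c<d , label a , label b , label-block a , label-block b , a≁b ,
        (∈-label a , subst (c ∈_) (sym a~c) (∈-label c)) ,
        (∈-label b , subst (d ∈_) (sym b~d) (∈-label d)))

  -- The reflected label of `i` is again a block of `π`, and it contains both opposites.
  label-opposite : SelfComplementary π → ∀ {i j} → label i ≡ label j →
    label (opposite i) ≡ label (opposite j)
  label-opposite sc {i} {j} i~j = trans (sym (block≡label B (∈-reflect⁺ (∈-label i))))
      (block≡label B (∈-reflect⁺ (subst (j ∈_) (sym i~j) (∈-label j))))
    where
    B : Block π (reflect (label i))
    B = Equivalence.to (sc _) (label i , label-block i , refl)

  label⇒≈ : ∀ {R : Rel (Fin n) 0ℓ} (E : IsDecEquivalence R) →
    (∀ {i j} → R i j ⇔ label i ≡ label j) →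
    Quotient.partition E ≈ π
  label⇒≈ E same A = mk⇔
    (λ { (i , refl) → subst (Block π) (sym (class≡label i)) (label-block i) })
    (λ bA → let i , i∈A = nonempty π bA in i , trans (block≡label bA i∈A) (sym (class≡label i)))
    where
    open Quotient E
    class≡label : ∀ i → class i ≡ label i
    class≡label i = ⊆-antisym
      (λ {j} j∈ → subst (j ∈_) (sym (Equivalence.to same (∈-class⁻ j∈))) (∈-label j))
      (λ {j} j∈ → ∈-class⁺ (Equivalence.from same (block≡label (label-block i) j∈)))

-- From symmetric walks to partitions and back

opposite-sum : ∀ {n} (i : Fin n) → suc (toℕ i + toℕ (opposite i)) ≡ n
opposite-sum i = trans (cong (suc (toℕ i) +_) (opposite-prop i)) (m+[n∸m]≡n (toℕ<n i))

module FromWalk {n H} (walk : SymmetricWalk n H) where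

  _~_ : Rel (Fin n) 0ℓ
  i ~ j = SameBlock H (toℕ i) (toℕ j)

  isDecEquivalence : IsDecEquivalence _~_
  isDecEquivalence = record
    { isEquivalence = record
      { refl = sameBlock-refl ; sym = sameBlock-sym ; trans = sameBlock-trans }
    ; _≟_           = λ i j → sameBlock? (toℕ i) (toℕ j)
    }

  open Quotient isDecEquivalence public
    using (partition; partition-noncrossing; partition-selfComplementary)

  noncrossing : Noncrossing partition
  noncrossing = partition-noncrossing sameBlock-noncrossing

  selfComplementary : SelfComplementary partition
  selfComplementary = partition-selfComplementary
    λ {i} {j} → SymmetricWalk.sameBlock-mirror walk (opposite-sum i) (opposite-sum j)

module ToWalk {n} (π : Partition n) (nc : Noncrossing π) (sc : SelfComplementary π) where
  open Label π

  -- Indices from `n` on get the empty set, which is never a block.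
  labelℕ : ℕ → Subset n
  labelℕ i with i <? n
  ... | yes i<n = label (fromℕ< i<n)
  ... | no  _   = ∅

  labelℕ-fromℕ< : ∀ {i} (i<n : i < n) → labelℕ i ≡ label (fromℕ< i<n)
  labelℕ-fromℕ< {i} i<n with i <? n
  ... | yes _   = refl
  ... | no i≮n = contradiction i<n i≮n

  labelℕ-toℕ : ∀ i → labelℕ (toℕ i) ≡ label i
  labelℕ-toℕ i = trans (labelℕ-fromℕ< (toℕ<n i)) (cong label (toℕ-injective (toℕ-fromℕ< (toℕ<n i))))

  label-transfer : ∀ {i j} (i<n : i < n) (j<n : j < n) →
    labelℕ i ≡ labelℕ j → label (fromℕ< i<n) ≡ label (fromℕ< j<n)
  label-transfer i<n j<n eq = trans (sym (labelℕ-fromℕ< i<n)) (trans eq (labelℕ-fromℕ< j<n))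

  labelℕ-noncrossing : ∀ {a b c d} → a < b → b < c → c < d → d < n →
    labelℕ a ≡ labelℕ c → labelℕ b ≡ labelℕ d → labelℕ a ≡ labelℕ b
  labelℕ-noncrossing a<b b<c c<d d<n a~c b~d =
    trans (labelℕ-fromℕ< a<n) (trans
      (label-noncrossing nc
        (fromℕ<-mono a<n b<n a<b) (fromℕ<-mono b<n c<n b<c) (fromℕ<-mono c<n d<n c<d)
        (label-transfer a<n c<n a~c) (label-transfer b<n d<n b~d))
      (sym (labelℕ-fromℕ< b<n)))
    where
    c<n = <-trans c<d d<n
    b<n = <-trans b<c c<n
    a<n = <-trans a<b b<n
    fromℕ<-mono : ∀ {i j} (i<n : i < n) (j<n : j < n) → i < j → fromℕ< i<n Fin.< fromℕ< j<n
    fromℕ<-mono i<n j<n = subst₂ _<_ (sym (toℕ-fromℕ< i<n)) (sym (toℕ-fromℕ< j<n))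

  labelℕ-opposite : ∀ {i i′} → suc (i + i′) ≡ n → (i<n : i < n) →
    labelℕ i′ ≡ label (opposite (fromℕ< i<n))
  labelℕ-opposite {i} {i′} i+i′ i<n = trans (cong labelℕ i′≡) (labelℕ-toℕ _)
    where
    i′≡ : i′ ≡ toℕ (opposite (fromℕ< i<n))
    i′≡ = +-cancelˡ-≡ (suc i) _ _ (trans i+i′ (trans (sym (opposite-sum (fromℕ< i<n)))
            (cong (λ k → suc (k + toℕ (opposite (fromℕ< i<n)))) (toℕ-fromℕ< i<n))))

  labelℕ-symmetric : ∀ {i i′ j j′} → suc (i + i′) ≡ n → suc (j + j′) ≡ n →
    labelℕ i ≡ labelℕ j → labelℕ i′ ≡ labelℕ j′
  labelℕ-symmetric {i} {i′} {j} {j′} i+i′ j+j′ eq = trans (labelℕ-opposite i+i′ i<n)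
    (trans (label-opposite sc (label-transfer i<n j<n eq)) (sym (labelℕ-opposite j+j′ j<n)))
    where
    i<n = mirror-< i i′ i+i′
    j<n = mirror-< j j′ j+j′

  open FirstLastWalk (≡-dec _≟ᵇ_) n labelℕ labelℕ-noncrossing labelℕ-symmetric public
    using (H; walk; label⇒sameBlock; sameBlock⇒label)

  -- Stated for any walk agreeing with `H` up to time `double n`, because folding the recovered path
  -- gives `H` only pointwise.
  fromWalk≈ : ∀ {K} (walk : SymmetricWalk n K) → (∀ {t} → t ≤ double n → K t ≡ H t) →
    FromWalk.partition walk ≈ π
  fromWalk≈ walk eq = label⇒≈ (FromWalk.isDecEquivalence walk) λ {i} {j} → mk⇔
    (λ r → trans (sym (labelℕ-toℕ i)) (trans
       (sameBlock⇒label (toℕ<n i) (toℕ<n j) (sameBlock-cong eq (toℕ<n i) (toℕ<n j) r))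
       (labelℕ-toℕ j)))
    (λ e → sameBlock-cong (sym ∘ eq) (toℕ<n i) (toℕ<n j)
       (label⇒sameBlock (toℕ<n i) (toℕ<n j) (trans (labelℕ-toℕ i) (trans e (sym (labelℕ-toℕ j))))))

-- The bijection between paths and partitions

fromPath : ∀ {n} → Path n 0 → Partition n
fromPath p = FromWalk.partition (fold-walk p)

-- The partition determines the block relation, hence by `walk-unique` the folded walk, whose first
-- half is the path.
fromPath-injective : ∀ {n} (p q : Path n 0) → fromPath p ≈ fromPath q → p ≡ q
fromPath-injective {n} p q p≈q = height-injective p q λ t≤n →
  trans (sym (fold-low n (height p) t≤n))
    (trans (walk-unique (fold-walk p) (fold-walk q) (transfer p q p≈q) (transfer q p (⇔-sym ∘ p≈q))
              (≤-trans t≤n (n≤double n)))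
           (fold-low n (height q) t≤n))
  where
  transfer : ∀ p q → fromPath p ≈ fromPath q → ∀ {i j} → i < n → j < n →
    SameBlock (fold n (height p)) i j → SameBlock (fold n (height q)) i j
  transfer p q p≈q i<n j<n r = subst₂ (SameBlock _) (toℕ-fromℕ< i<n) (toℕ-fromℕ< j<n)
    (partition-injective
      (FromWalk.isDecEquivalence (fold-walk p)) (FromWalk.isDecEquivalence (fold-walk q)) p≈q
      (subst₂ (SameBlock _) (sym (toℕ-fromℕ< i<n)) (sym (toℕ-fromℕ< j<n)) r))

fromPath-surjective : ∀ {n} (π : Partition n) → Noncrossing π → SelfComplementary π →
  ∃ λ p → fromPath p ≈ π
fromPath-surjective {n} π nc sc = p , fromWalk≈ (fold-walk p) agree
  where
  open ToWalk π nc sc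
  open SymmetricWalk walk using (step; mirror)
  path = fromHeights n H (λ t<n → step (<-≤-trans t<n (n≤double n)))
  p = proj₁ path
  low : ∀ {t} → t ≤ n → fold n (height p) t ≡ H t
  low t≤n = trans (fold-low n (height p) t≤n) (proj₂ path t≤n)
  agree : ∀ {t} → t ≤ double n → fold n (height p) t ≡ H t
  agree {t} t≤2n with ≤-total t n
  ... | inj₁ t≤n = low t≤n
  -- Both walks are symmetric, so the second half is compared at the mirror time `t′`.
  ... | inj₂ n≤t = trans (fold-mirror n (height p) t t′ t+t′)
    (trans (low t′≤n) (sym (mirror {t} {t′} t+t′)))
    where
    t′ = double n ∸ t
    t+t′ = m+[n∸m]≡n t≤2n
    t′≤n : t′ ≤ n
    t′≤n = +-cancelˡ-≤ n t′ n (subst (n + t′ ≤_) (trans t+t′ (double≡n+n n)) (+-monoˡ-≤ t′ n≤t))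

theorem1 : (n : ℕ) → 1 ≤ n →
    HasCardinality (selfComplementaryNoncrossing n) (n C ⌊ n /2⌋)
theorem1 n _ = record
  { to        = λ i → let walk = fold-walk (path i) in
                  fromPath (path i) , FromWalk.noncrossing walk , FromWalk.selfComplementary walk
  ; cong      = λ { refl A → ⇔-id _ }
  ; bijective =
      (λ {i} {j} eq → Injection.injective (↔⇒↣ (C↔Path n)) (fromPath-injective (path i) (path j) eq)) ,
      λ (π , nc , sc) → let p , eq = fromPath-surjective π nc sc in
        Inverse.from (C↔Path n) p ,
        -- Going from `p` to its index and back gives `p` only propositionally, hence the transport.
        λ { refl → subst (λ q → fromPath q ≈ π) (sym (Inverse.strictlyInverseˡ (C↔Path n) p)) eq }
  }
  where
  path = Inverse.to (C↔Path n)
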